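{- All connected graphs on at least three vertices are reconstructible if and only if all connected graphs $G$ on at least three vertices with $\gamma(G)=2$ or $\operatorname{diam}(G)=\operatorname{diam}(\overline{G})=2$ are reconstructible.
   Context: All graphs are finite, simple and undirected. $\gamma(G)$ denotes the domination number, $\operatorname{diam}(G)$ the diameter (infinite if $G$ is disconnected), and $\overline{G}$ the complement of $G$. For a vertex $v$, the card $G-v$ is the unlabeled graph obtained by deleting $v$; the deck $\mathscr{D}(G)$ is the multiset of all cards of $G$ up to isomorphism. $G$ is reconstructible if every graph $H$ with $\mathscr{D}(H)=\mathscr{D}(G)$ is isomorphic to $G$. -}

module Defs where

open import Data.Fin.Base using (Fin; punchIn)
open import Data.Fin.Properties using (_≟_)
open import Data.Fin.Subset using (Subset; _∈_; ∣_∣)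
open import Data.List.Base using (List; map; allFin)
open import Data.Nat.Base using (ℕ; suc; pred; _≤_)
open import Data.Product.Base using (∃; ∃₂; _×_; _,_; proj₁; proj₂)
open import Data.Sum.Base using (_⊎_)
open import Function.Base using (_∘_)
open import Function.Bundles using (_↔_; _⇔_; Inverse; Equivalence; mk⇔)
open import Function.Construct.Composition using (_↔-∘_; _⇔-∘_)
open import Function.Construct.Identity using (↔-id; ⇔-id)
open import Function.Construct.Symmetry using (↔-sym; ⇔-sym)
open import Level using (0ℓ) renaming (suc to lsuc)
open import Relation.Binary.Bundles using (Setoid)
open import Relation.Binary.Core using (Rel)
open import Relation.Binary.Definitions using (Decidable; Symmetric)
open import Relation.Binary.PropositionalEquality using (_≡_; _≢_; refl; sym; subst₂)
open import Relation.Nullary.Decidable using (¬?; _×-dec_)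
open import Relation.Nullary.Negation using (¬_)

record Graph : Set₁ where
  field
    order : ℕ

  Vertex : Set
  Vertex = Fin order

  field
    _~_      : Rel Vertex 0ℓ
    _~?_     : Decidable _~_
    ~-sym    : Symmetric _~_
    ~-irrefl : ∀ v → ¬ (v ~ v)

open Graph using (order; Vertex)

complement : Graph → Graph
complement G = record
  { order    = order G
  ; _~_      = λ u v → u ≢ v × ¬ (u ~ v)
  ; _~?_     = λ u v → ¬? (u ≟ v) ×-dec ¬? (u ~? v)
  ; ~-sym    = λ (u≢v , u≁v) → u≢v ∘ sym , u≁v ∘ ~-sym
  ; ~-irrefl = λ v v~v → proj₁ v~v refl
  }
  where open Graph G hiding (order; Vertex)

record _≅_ (G H : Graph) : Set where
  private
    module G = Graph G
    module H = Graph H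
  field
    bijection : G.Vertex ↔ H.Vertex
  open Inverse bijection public using (to; from)
  field
    adjacency : ∀ u v → (u G.~ v) ⇔ (to u H.~ to v)

infix 4 _≅_

≅-refl : ∀ {G} → G ≅ G
≅-refl = record { bijection = ↔-id _ ; adjacency = λ _ _ → ⇔-id _ }

≅-sym : ∀ {G H} → G ≅ H → H ≅ G
≅-sym {G} {H} φ = record
  { bijection = ↔-sym bijection
  ; adjacency = λ u v → mk⇔
      (λ u~v → Equivalence.from (adjacency (from u) (from v))
                 (subst₂ H._~_ (sym (toFrom u)) (sym (toFrom v)) u~v))
      (λ u~v → subst₂ H._~_ (toFrom u) (toFrom v)
                 (Equivalence.to (adjacency (from u) (from v)) u~v))
  }
  where
  module H = Graph H
  open _≅_ φ
  toFrom : ∀ v → to (from v) ≡ v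
  toFrom = Inverse.strictlyInverseˡ bijection

≅-trans : ∀ {G H K} → G ≅ H → H ≅ K → G ≅ K
≅-trans φ ψ = record
  { bijection = ψ.bijection ↔-∘ φ.bijection
  ; adjacency = λ u v → ψ.adjacency (φ.to u) (φ.to v) ⇔-∘ φ.adjacency u v
  }
  where
  module φ = _≅_ φ
  module ψ = _≅_ ψ

≅-setoid : Setoid (lsuc 0ℓ) 0ℓ
≅-setoid = record
  { Carrier       = Graph
  ; _≈_           = _≅_
  ; isEquivalence = record { refl = ≅-refl ; sym = ≅-sym ; trans = ≅-trans }
  }

open import Data.List.Relation.Binary.Permutation.Setoid ≅-setoid using (_↭_)

-- The vertices other than v, listed in order by Fin (pred n).
others : ∀ {n} → Fin n → Fin (pred n) → Fin n
others {suc n} = punchIn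

infixl 6 _-_

_-_ : (G : Graph) → Vertex G → Graph
G - v = record
  { order    = pred (order G)
  ; _~_      = λ x y → others v x ~ others v y
  ; _~?_     = λ x y → others v x ~? others v y
  ; ~-sym    = ~-sym
  ; ~-irrefl = λ x → ~-irrefl (others v x)
  }
  where open Graph G hiding (order; Vertex)

deck : Graph → List Graph
deck G = map (G -_) (allFin (order G))

-- Decks are multisets of isomorphism classes, so they are compared by
-- permutation up to _≅_.
Reconstructible : Graph → Set₁
Reconstructible G = ∀ H → deck H ↭ deck G → H ≅ G

data Walk (G : Graph) : Vertex G → Vertex G → ℕ → Set where
  []  : ∀ {u} → Walk G u u 0
  _∷_ : ∀ {u v w k} → Graph._~_ G u v → Walk G v w k → Walk G u w (suc k)

Connected : Graph → Set
Connected G = ∀ u v → ∃ λ k → Walk G u v k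

IsDistance : (G : Graph) → Vertex G → Vertex G → ℕ → Set
IsDistance G u v d = Walk G u v d × (∀ k → Walk G u v k → d ≤ k)

-- The (finite) diameter of G is d; this holds for no d when G is disconnected,
-- where the diameter is infinite.
IsDiameter : Graph → ℕ → Set
IsDiameter G d =
  (∀ u v → ∃ λ e → IsDistance G u v e × e ≤ d) ×
  (∃₂ λ u v → IsDistance G u v d)

Dominating : (G : Graph) → Subset (order G) → Set
Dominating G S = ∀ v → v ∈ S ⊎ ∃ λ u → u ∈ S × Graph._~_ G u v

IsDominationNumber : Graph → ℕ → Set
IsDominationNumber G k =
  (∃ λ S → Dominating G S × ∣ S ∣ ≡ k) ×
  (∀ S → Dominating G S → k ≤ ∣ S ∣)

{-# OPTIONS --safe #-}
-- Call a vertex universal if it dominates G on its own.  Counting edges over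
-- the deck determines |E(G)| when n ≥ 3, hence which cards come from a vertex
-- of degree n - 1; so a graph with a universal vertex is reconstructible.
-- If γ(G) ≥ 3, any two vertices have a common non-neighbour, so the complement
-- has diameter 2.  Then either diam(G) = 2, or G has two vertices at distance
-- at least 3; these dominate the complement, and γ(complement) = 2 because G
-- has no isolated vertex.  Finally, G is reconstructible when its complement is.
module Submission where

open import Defs
open import Data.Bool.Base using (if_then_else_)
open import Data.Empty using (⊥-elim)
open import Data.Fin.Base using (Fin; zero; suc; punchOut; fromℕ<)
open import Data.Fin.Permutation using (Permutation; insert; insert-punchIn)
open import Data.Fin.Properties using (_≟_; any?; all?; ¬∀⟶∃¬; punchIn-injective; punchInᵢ≢i; punchIn-punchOut)
open import Data.Fin.Subset using (Subset; _∈_; ∣_∣; ⁅_⁆; _∪_)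
open import Data.Fin.Subset.Properties using (x∈⁅x⁆; x∈p∪q⁺; ∣⁅x⁆∣≡1; ∪-identityˡ; ∪-identityʳ; x∈p⇒∣p-x∣<∣p∣; x∈p∧x≢y⇒x∈p-y)
open import Data.List.Base using (map; allFin; tabulate; length)
open import Data.List.Properties using (map-tabulate; length-map; length-tabulate)
open import Data.List.Relation.Binary.Permutation.Propositional using (↭ₛ⇒↭)
open import Data.List.Relation.Binary.Permutation.Setoid ≅-setoid using (_↭_; ↭-sym; ↭-trans; ↭-reflexive-≋)
open import Data.List.Relation.Binary.Pointwise as Pointwise using (Pointwise)
open import Data.List.Relation.Unary.Any using (Any; satisfied)
open import Data.Nat.Base using (ℕ; zero; suc; pred; _+_; _*_; _≤_; z≤n; s≤s)
open import Data.Nat.ListAction using () renaming (sum to sumList)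
open import Data.Nat.ListAction.Properties using (sum-↭)
open import Data.Nat.Properties using (+-0-commutativeMonoid; +-mono-≤; *-identityʳ; +-cancelˡ-≡; +-cancelʳ-≡; *-cancelˡ-≡; *-distribˡ-+; *-distribʳ-+; suc-injective; <-irrefl; ≤-trans; ≤-refl; ≤-<-trans)
open import Data.Nat.Tactic.RingSolver using (solve-∀)
open import Data.Product.Base using (∃; ∃₂; _×_; _,_; proj₂)
open import Data.Sum.Base using (_⊎_; inj₁; inj₂; [_,_]′)
open import Function.Base using (_∘_; id; const)
open import Function.Bundles using (_⇔_; Injection; Inverse; Equivalence; mk⇔)
open import Function.Construct.Identity using (↔-id)
open import Function.Properties.Inverse using (↔⇒↣)
open import Relation.Binary.PropositionalEquality using (_≡_; _≢_; refl; sym; trans; cong; cong₂; subst; subst₂; setoid; module ≡-Reasoning)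
open import Relation.Nullary.Decidable using (Dec; yes; no; does; ¬?; _×-dec_; _⊎-dec_; decidable-stable; dec-true; dec-false)
open import Relation.Nullary.Negation using (¬_; contradiction)

import Algebra.Properties.CommutativeMonoid.Sum as Sum
import Data.List.Relation.Binary.Permutation.Setoid.Properties as Permutation
import Data.List.Relation.Unary.Any.Properties as Any

open Sum +-0-commutativeMonoid using (sum; sum-cong-≗; ∑-distrib-+; sum-permute; sum-remove)
open Graph using (order; Vertex)

-- Deleting one index

others-injective : ∀ {n} (v : Fin n) {x y} → others v x ≡ others v y → x ≡ y
others-injective {suc n} v = punchIn-injective v _ _

others-≢ : ∀ {n} (v : Fin n) x → v ≢ others v x
others-≢ {suc n} v x = punchInᵢ≢i v x ∘ sym

others-cover : ∀ {n} (v w : Fin n) → v ≡ w ⊎ ∃ λ x → others v x ≡ w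
others-cover {suc n} v w with v ≟ w
... | yes v≡w = inj₁ v≡w
... | no  v≢w = inj₂ (punchOut v≢w , punchIn-punchOut v≢w)

-- This lifts an isomorphism between cards to a bijection of the full vertex sets by matching the
-- two deleted vertices.
extend : ∀ {m n} (u : Fin m) (v : Fin n) (π : Permutation (pred m) (pred n)) →
         ∃ λ (ρ : Permutation m n) →
           Inverse.to ρ u ≡ v ×
           (∀ x → Inverse.to ρ (others u x) ≡ others v (Inverse.to π x))
extend {suc m} {suc n} u v π = insert u v π , insert-at , insert-punchIn u v π
  where
  insert-at : Inverse.to (insert u v π) u ≡ v
  -- `insert` branches on this equality test, so its value at `u` computes only once the test is
  -- resolved.
  insert-at with u ≟ u
  ... | yes _   = refl
  ... | no  u≢u = contradiction refl u≢u

-- Sums over Fin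

sum-others : ∀ {n} (v : Fin n) (f : Fin n → ℕ) → sum f ≡ f v + sum (f ∘ others v)
sum-others {suc n} v f = sum-remove {i = v} f

sum-const : ∀ n c → sum {n} (const c) ≡ n * c
sum-const zero    c = refl
sum-const (suc n) c = cong (c +_) (sum-const n c)

sum-scale : ∀ {n} c (f : Fin n → ℕ) → sum (λ i → c * f i) ≡ c * sum f
-- For the empty sum the goal is `0 ≡ c * 0`, which needs induction on `c` since `_*_` recurses on
-- its left factor.
sum-scale {zero}  zero    f = refl
sum-scale {zero}  (suc c) f = sum-scale c f
sum-scale {suc n} c       f =
  trans (cong (c * f zero +_) (sum-scale c (f ∘ suc))) (sym (*-distribˡ-+ c (f zero) _))

sumList-tabulate : ∀ {n} (f : Fin n → ℕ) → sumList (tabulate f) ≡ sum f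
sumList-tabulate {zero}  f = refl
sumList-tabulate {suc n} f = cong (f zero +_) (sumList-tabulate (f ∘ suc))

sum-≤ : ∀ {n} (f : Fin n → ℕ) → (∀ i → f i ≤ 1) → sum f ≤ n
sum-≤ {zero}  f f≤1 = z≤n
sum-≤ {suc n} f f≤1 = +-mono-≤ (f≤1 zero) (sum-≤ (f ∘ suc) (f≤1 ∘ suc))

-- A zero summand at the head would force the remaining terms, each at most 1, to add up to more
-- than their number.
sum-maximal : ∀ {n} (f : Fin n → ℕ) → (∀ i → f i ≤ 1) → sum f ≡ n → ∀ i → f i ≡ 1
sum-maximal {suc n} f f≤1 Σf≡n i with f zero in f₀ | f≤1 zero
sum-maximal {suc n} f f≤1 Σf≡n i       | zero | _ =
  contradiction (subst (_≤ n) Σf≡n (sum-≤ (f ∘ suc) (f≤1 ∘ suc))) (<-irrefl refl)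
sum-maximal {suc n} f f≤1 Σf≡n zero    | suc zero | _ = f₀
sum-maximal {suc n} f f≤1 Σf≡n (suc i) | suc zero | _ =
  sum-maximal (f ∘ suc) (f≤1 ∘ suc) (suc-injective Σf≡n) i
sum-maximal {suc n} f f≤1 Σf≡n i       | suc (suc _) | s≤s ()

-- Counting edges

indicator : ∀ {P : Set} → Dec P → ℕ
indicator P? = if does P? then 1 else 0

indicator-≤1 : ∀ {P : Set} (P? : Dec P) → indicator P? ≤ 1
indicator-≤1 (yes _) = ≤-refl
indicator-≤1 (no  _) = z≤n

indicator-true : ∀ {P : Set} (P? : Dec P) → P → indicator P? ≡ 1
indicator-true P? p rewrite dec-true P? p = refl

indicator-true⁻ : ∀ {P : Set} (P? : Dec P) → indicator P? ≡ 1 → P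
indicator-true⁻ (yes p) _ = p

indicator-false : ∀ {P : Set} (P? : Dec P) → ¬ P → indicator P? ≡ 0
indicator-false P? ¬p rewrite dec-false P? ¬p = refl

indicator-⇔ : ∀ {P Q : Set} (P? : Dec P) (Q? : Dec Q) → P ⇔ Q → indicator P? ≡ indicator Q?
indicator-⇔ (yes p) Q? P⇔Q = sym (indicator-true Q? (Equivalence.to P⇔Q p))
indicator-⇔ (no ¬p) Q? P⇔Q = sym (indicator-false Q? (¬p ∘ Equivalence.from P⇔Q))

adj : (G : Graph) → Vertex G → Vertex G → ℕ
adj G u v = indicator (Graph._~?_ G u v)

degree : (G : Graph) → Vertex G → ℕ
degree G v = sum (adj G v)

-- Twice the number of edges.
totalDegree : Graph → ℕ
totalDegree G = sum (degree G)

-- The diagonal term vanishes by irreflexivity.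
degree-others : ∀ G v → degree G v ≡ sum (adj G v ∘ others v)
degree-others G v = trans (sum-others v (adj G v))
  (cong (_+ sum (adj G v ∘ others v)) (indicator-false (v ~? v) (~-irrefl v)))
  where open Graph G hiding (order; Vertex)

-- Deleting `v` strikes out its row and its column of the adjacency matrix; by symmetry each sums to
-- the degree of `v`.
totalDegree-delete : ∀ G v → totalDegree G ≡ 2 * degree G v + totalDegree (G - v)
totalDegree-delete G v = begin
  totalDegree G
    ≡⟨ sum-others v (degree G) ⟩
  degree G v + sum (degree G ∘ others v)
    ≡⟨ cong (degree G v +_) (sum-cong-≗ (λ x → sum-others v (adj G (others v x)))) ⟩
  degree G v + sum (λ x → adj G (others v x) v + degree (G - v) x)
    ≡⟨ cong (degree G v +_) (∑-distrib-+ (λ x → adj G (others v x) v) (degree (G - v))) ⟩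
  degree G v + (sum (λ x → adj G (others v x) v) + totalDegree (G - v))
    ≡⟨ cong (λ s → degree G v + (s + totalDegree (G - v)))
         (trans (sum-cong-≗ (λ x → adj-sym (others v x) v)) (sym (degree-others G v))) ⟩
  degree G v + (degree G v + totalDegree (G - v))
    ≡⟨ rearrange (degree G v) _ ⟩
  2 * degree G v + totalDegree (G - v) ∎
  where
  open ≡-Reasoning
  open Graph G hiding (order; Vertex)
  adj-sym : ∀ u w → adj G u w ≡ adj G w u
  adj-sym u w = indicator-⇔ (u ~? w) (w ~? u) (mk⇔ ~-sym ~-sym)
  rearrange : ∀ d t → d + (d + t) ≡ 2 * d + t
  rearrange = solve-∀

totalDegree-≅ : ∀ {G H} → G ≅ H → totalDegree G ≡ totalDegree H
totalDegree-≅ {G} {H} φ = sym (trans (sum-permute (degree H) bijection) (sum-cong-≗ λ u →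
  trans (sum-permute (adj H (to u)) bijection) (sum-cong-≗ λ v →
    sym (indicator-⇔ (Graph._~?_ G u v) (Graph._~?_ H (to u) (to v)) (adjacency u v)))))
  where open _≅_ φ

deckTotal : Graph → ℕ
deckTotal G = sumList (map totalDegree (deck G))

deckTotal-≡ : ∀ G → deckTotal G ≡ sum (λ v → totalDegree (G - v))
deckTotal-≡ G = trans
  (cong (sumList ∘ map totalDegree) (map-tabulate id (G -_)))
  (trans (cong sumList (map-tabulate (G -_) totalDegree)) (sumList-tabulate (totalDegree ∘ (G -_))))

-- Kelly's count: each edge survives in all but two of the cards.
totalDegree-deck : ∀ G → order G * totalDegree G ≡ 2 * totalDegree G + deckTotal G
totalDegree-deck G = begin
  order G * totalDegree G
    ≡⟨ sum-const (order G) (totalDegree G) ⟨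
  sum {order G} (const (totalDegree G))
    ≡⟨ sum-cong-≗ (totalDegree-delete G) ⟩
  sum (λ v → 2 * degree G v + totalDegree (G - v))
    ≡⟨ ∑-distrib-+ (λ v → 2 * degree G v) (λ v → totalDegree (G - v)) ⟩
  sum (λ v → 2 * degree G v) + sum (λ v → totalDegree (G - v))
    ≡⟨ cong₂ _+_ (sum-scale 2 (degree G)) (sym (deckTotal-≡ G)) ⟩
  2 * totalDegree G + deckTotal G ∎
  where open ≡-Reasoning

-- Comparing decks

deckTotal-↭ : ∀ {G H} → deck G ↭ deck H → deckTotal G ≡ deckTotal H
deckTotal-↭ p = sum-↭ (↭ₛ⇒↭ (Permutation.map⁺ ≅-setoid (setoid ℕ) totalDegree-≅ p))

order-↭ : ∀ {G H} → deck G ↭ deck H → order G ≡ order H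
order-↭ {G} {H} p = trans (sym (length-deck G)) (trans (Permutation.xs↭ys⇒|xs|≡|ys| ≅-setoid p) (length-deck H))
  where
  length-deck : ∀ G → length (deck G) ≡ order G
  length-deck G = trans (length-map (G -_) (allFin (order G))) (length-tabulate id)

-- Both total degrees solve Kelly's equation `n * t ≡ 2 * t + d` for the same `n` and `d`. The
-- solution is unique because `n - 2` is positive.
totalDegree-↭ : ∀ {G H} → 3 ≤ order G → deck G ↭ deck H → totalDegree G ≡ totalDegree H
totalDegree-↭ {G} {H} n≥3 p =
  cancel (order G) n≥3 (totalDegree-deck G)
    (subst₂ (λ n s → n * totalDegree H ≡ 2 * totalDegree H + s)
      (sym (order-↭ {G} {H} p)) (sym (deckTotal-↭ {G} {H} p)) (totalDegree-deck H))
  where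
  cancel : ∀ n {s t d} → 3 ≤ n → n * s ≡ 2 * s + d → n * t ≡ 2 * t + d → s ≡ t
  cancel (suc (suc (suc n))) {s} {t} {d} (s≤s (s≤s (s≤s z≤n))) eₛ eₜ = *-cancelˡ-≡ s t (suc n) (trans (reduce s eₛ) (sym (reduce t eₜ)))
    where
    reduce : ∀ r → (3 + n) * r ≡ 2 * r + d → suc n * r ≡ d
    -- The order `3 + n` is split as `2 + suc n`, so the factor left to cancel is a successor.
    reduce r e = +-cancelˡ-≡ (2 * r) _ _ (trans (sym (*-distribʳ-+ r 2 (suc n))) e)

matching-card : ∀ {G H} → deck G ↭ deck H → ∀ v → ∃ λ u → (G - v) ≅ (H - u)
matching-card {G} {H} p v = satisfied (Any.map⁻ (Permutation.∈-resp-↭ ≅-setoid p G-v∈deck))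
  where
  G-v∈deck : Any ((G - v) ≅_) (deck G)
  G-v∈deck = Any.map⁺ (Any.tabulate⁺ v (≅-refl {G - v}))

-- Complements

-- The non-adjacency conditions agree literally; only the inequality of vertices has to be carried
-- through `others v`.
complement-delete : ∀ G v → complement (G - v) ≅ (complement G - v)
complement-delete G v = record
  { bijection = ↔-id _
  ; adjacency = λ x y → mk⇔
      (λ (x≢y , x≁y) → x≢y ∘ others-injective v , x≁y)
      (λ (x≢y , x≁y) → x≢y ∘ cong (others v) , x≁y)
  }

complement-cong : ∀ {G H} → G ≅ H → complement G ≅ complement H
complement-cong {G} {H} φ = record
  { bijection = bijection
  ; adjacency = λ u v → mk⇔
      (λ (u≢v , u≁v) → u≢v ∘ Injection.injective (↔⇒↣ bijection) , u≁v ∘ Equivalence.from (adjacency u v))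
      (λ (u≢v , u≁v) → u≢v ∘ cong to , u≁v ∘ Equivalence.to (adjacency u v))
  }
  where open _≅_ φ

-- Decidability of adjacency removes the double negation.
complement-involutive : ∀ G → complement (complement G) ≅ G
complement-involutive G = record
  { bijection = ↔-id _
  ; adjacency = λ u v → mk⇔
      (λ (u≢v , ¬u≁v) → decidable-stable (u ~? v) (λ u≁v → ¬u≁v (u≢v , u≁v)))
      (λ u~v → (λ { refl → ~-irrefl u u~v }) , λ (_ , u≁v) → u≁v u~v)
  }
  where open Graph G hiding (order; Vertex)

complement-deck : ∀ G → map complement (deck G) ↭ deck (complement G)
complement-deck G = ↭-reflexive-≋ (subst₂ (Pointwise _≅_)
  (sym (trans (cong (map complement) (map-tabulate id (G -_))) (map-tabulate (G -_) complement)))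
  (sym (map-tabulate id (complement G -_)))
  (Pointwise.tabulate⁺ (complement-delete G)))

complement-deck-↭ : ∀ {G H} → deck G ↭ deck H → deck (complement G) ↭ deck (complement H)
complement-deck-↭ {G} {H} p = ↭-trans (↭-sym (complement-deck G))
  (↭-trans (Permutation.map⁺ ≅-setoid ≅-setoid (λ {A} {B} → complement-cong {A} {B}) p)
    (complement-deck H))

-- Equal decks have equal complemented decks, so the complements are isomorphic; complementing once
-- more gives back the graphs.
reconstructible-complement : ∀ G → Reconstructible (complement G) → Reconstructible G
reconstructible-complement G rec H p =
  ≅-trans {H} {complement (complement H)} {G} (≅-sym {complement (complement H)} {H} (complement-involutive H))
    (≅-trans {complement (complement H)} {complement (complement G)} {G}
      (complement-cong {complement H} {complement G} (rec (complement H) (complement-deck-↭ {H} {G} p)))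
      (complement-involutive G))

-- Domination

-- Membership of `w` in the closed neighbourhood of `u`.
Covers : (G : Graph) → Vertex G → Vertex G → Set
Covers G u w = u ≡ w ⊎ Graph._~_ G u w

covers? : ∀ G u w → Dec (Covers G u w)
covers? G u w = (u ≟ w) ⊎-dec Graph._~?_ G u w

Universal : (G : Graph) → Vertex G → Set
Universal G u = ∀ w → Covers G u w

universal? : ∀ G u → Dec (Universal G u)
universal? G u = all? (covers? G u)

-- The two vertices may coincide; they are distinct once no vertex is universal.
CoveringPair : (G : Graph) → Vertex G → Vertex G → Set
CoveringPair G u v = ∀ w → Covers G u w ⊎ Covers G v w

coveringPair? : ∀ G u v → Dec (CoveringPair G u v)
coveringPair? G u v = all? λ w → covers? G u w ⊎-dec covers? G v w

¬universal⇒uncovered : ∀ G {u} → ¬ Universal G u → ∃ λ w → ¬ Covers G u w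
¬universal⇒uncovered G {u} = ¬∀⟶∃¬ (order G) (Covers G u) (covers? G u)

-- Graphs with a universal vertex

universal-~others : ∀ G {u} → Universal G u → ∀ x → Graph._~_ G u (others u x)
universal-~others G {u} univ x = [ (λ u≡ → contradiction u≡ (others-≢ u x)) , id ]′ (univ (others u x))

universal⇒degree : ∀ G {u} → Universal G u → degree G u ≡ pred (order G)
universal⇒degree G {u} univ = trans (degree-others G u)
  (trans (sum-cong-≗ (λ x → indicator-true (Graph._~?_ G u (others u x)) (universal-~others G univ x)))
    (trans (sum-const (pred (order G)) 1) (*-identityʳ _)))

-- The degree is a sum of `pred (order G)` indicators, so reaching that value forces each of them to
-- be 1.
degree⇒universal : ∀ G {u} → degree G u ≡ pred (order G) → Universal G u
degree⇒universal G {u} deg w with others-cover u w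
... | inj₁ u≡w        = inj₁ u≡w
... | inj₂ (x , refl) = inj₂ (indicator-true⁻ (u ~? others u x)
        (sum-maximal (adj G u ∘ others u) (λ y → indicator-≤1 (u ~? others u y))
          (trans (sym (degree-others G u)) deg) x))
  where open Graph G hiding (order; Vertex)

-- Pairs avoiding the deleted vertices are handled by the isomorphism of cards, and a pair of
-- distinct vertices containing one of them is always an edge on both sides.
≅-from-universal : ∀ {G H u v} → Universal G u → Universal H v → (G - u) ≅ (H - v) → G ≅ H
≅-from-universal {G} {H} {u} {v} univᵤ univᵥ φ with extend u v (_≅_.bijection φ)
... | ρ , ρu≡v , ρ-others = record { bijection = ρ ; adjacency = adjacent }
  where
  module G = Graph G
  module H = Graph H
  to = Inverse.to ρ

  adjacent : ∀ a b → (a G.~ b) ⇔ (to a H.~ to b)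
  adjacent a b with others-cover u a | others-cover u b
  ... | inj₁ refl | inj₁ refl = mk⇔ (⊥-elim ∘ G.~-irrefl u) (⊥-elim ∘ H.~-irrefl (to u))
  ... | inj₁ refl | inj₂ (y , refl) rewrite ρu≡v | ρ-others y =
        mk⇔ (λ _ → universal-~others H univᵥ _) (λ _ → universal-~others G univᵤ y)
  ... | inj₂ (x , refl) | inj₁ refl rewrite ρu≡v | ρ-others x =
        mk⇔ (λ _ → H.~-sym (universal-~others H univᵥ _)) (λ _ → G.~-sym (universal-~others G univᵤ x))
  ... | inj₂ (x , refl) | inj₂ (y , refl) rewrite ρ-others x | ρ-others y =
        _≅_.adjacency φ x y

-- The deck fixes the total degree, and subtracting that of a card leaves twice the degree of the
-- deleted vertex. Hence the card of `H` matching `G - v` also arises from a universal vertex.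
universal⇒reconstructible : ∀ G {v} → 3 ≤ order G → Universal G v → Reconstructible G
universal⇒reconstructible G {v} n≥3 univ H p with matching-card {G} {H} (↭-sym p) v
... | u , φ = ≅-sym {G} {H} (≅-from-universal {G} {H} univ (degree⇒universal H degree-u) φ)
  where
  open ≡-Reasoning
  same-degree : degree H u ≡ degree G v
  same-degree = *-cancelˡ-≡ _ _ 2 (+-cancelʳ-≡ (totalDegree (H - u)) _ _ (begin
    2 * degree H u + totalDegree (H - u)  ≡⟨ totalDegree-delete H u ⟨
    totalDegree H                         ≡⟨ totalDegree-↭ {G} {H} n≥3 (↭-sym p) ⟨
    totalDegree G                         ≡⟨ totalDegree-delete G v ⟩
    2 * degree G v + totalDegree (G - v)  ≡⟨ cong (2 * degree G v +_) (totalDegree-≅ {G - v} {H - u} φ) ⟩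
    2 * degree G v + totalDegree (H - u)  ∎))
  degree-u : degree H u ≡ pred (order H)
  degree-u = trans same-degree
    (trans (universal⇒degree G univ) (cong pred (sym (order-↭ {H} {G} p))))

-- Domination number two

∣⁅u⁆∪⁅v⁆∣≡2 : ∀ {n} {u v : Fin n} → u ≢ v → ∣ ⁅ u ⁆ ∪ ⁅ v ⁆ ∣ ≡ 2
∣⁅u⁆∪⁅v⁆∣≡2 {u = zero}  {zero}  u≢v = contradiction refl u≢v
∣⁅u⁆∪⁅v⁆∣≡2 {u = zero}  {suc v} _   = cong suc (trans (cong ∣_∣ (∪-identityˡ ⁅ v ⁆)) (∣⁅x⁆∣≡1 v))
∣⁅u⁆∪⁅v⁆∣≡2 {u = suc u} {zero}  _   = cong suc (trans (cong ∣_∣ (∪-identityʳ ⁅ u ⁆)) (∣⁅x⁆∣≡1 u))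
∣⁅u⁆∪⁅v⁆∣≡2 {u = suc u} {suc v} u≢v = ∣⁅u⁆∪⁅v⁆∣≡2 (u≢v ∘ cong suc)

-- Removing `y` and then `x` lowers the cardinality strictly each time.
two-elements : ∀ {n} {S : Subset n} {x y} → x ∈ S → y ∈ S → x ≢ y → 2 ≤ ∣ S ∣
two-elements x∈S y∈S x≢y =
  ≤-<-trans (≤-<-trans z≤n (x∈p⇒∣p-x∣<∣p∣ (x∈p∧x≢y⇒x∈p-y x∈S x≢y))) (x∈p⇒∣p-x∣<∣p∣ y∈S)

dominationNumber-2 : ∀ G {u v} → (∀ w → ¬ Universal G w) → CoveringPair G u v → IsDominationNumber G 2
dominationNumber-2 G {u} {v} ¬univ pair =
  (⁅ u ⁆ ∪ ⁅ v ⁆ , dominating , ∣⁅u⁆∪⁅v⁆∣≡2 u≢v) , minimal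
  where
  u≢v : u ≢ v
  u≢v refl = ¬univ u λ w → [ id , id ]′ (pair w)

  covers⇒dominates : ∀ {S a w} → a ∈ S → Covers G a w → w ∈ S ⊎ ∃ λ b → b ∈ S × Graph._~_ G b w
  covers⇒dominates a∈S (inj₁ refl) = inj₁ a∈S
  covers⇒dominates a∈S (inj₂ a~w)  = inj₂ (_ , a∈S , a~w)

  dominating : Dominating G (⁅ u ⁆ ∪ ⁅ v ⁆)
  dominating w = [ covers⇒dominates (x∈p∪q⁺ (inj₁ (x∈⁅x⁆ u)))
                 , covers⇒dominates (x∈p∪q⁺ (inj₂ (x∈⁅x⁆ v))) ]′ (pair w)

  coverer : ∀ S → Dominating G S → ∀ w → ∃ λ a → a ∈ S × Covers G a w
  coverer S dom w with dom w
  ... | inj₁ w∈S             = w , w∈S , inj₁ refl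
  ... | inj₂ (a , a∈S , a~w) = a , a∈S , inj₂ a~w

  minimal : ∀ S → Dominating G S → 2 ≤ ∣ S ∣
  -- Dominating `u` yields some member `a` of `S`; a vertex that `a` misses then requires a second
  -- member `b`.
  minimal S dom with coverer S dom u
  ... | a , a∈S , _ with ¬universal⇒uncovered G (¬univ a)
  ... | w , ¬a-covers with coverer S dom w
  ... | b , b∈S , b-covers = two-elements a∈S b∈S λ { refl → ¬a-covers b-covers }

-- Distances

-- Distance at most 2, phrased without walks so that it is decidable by finite search.
Near : (G : Graph) → Vertex G → Vertex G → Set
Near G u v = Covers G u v ⊎ ∃ λ w → u ~ w × w ~ v
  where open Graph G hiding (order; Vertex)

near? : ∀ G u v → Dec (Near G u v)
near? G u v = covers? G u v ⊎-dec any? λ w → (u ~? w) ×-dec (w ~? v)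
  where open Graph G hiding (order; Vertex)

near⇒connected : ∀ G → (∀ u v → Near G u v) → Connected G
near⇒connected G near u v with near u v
... | inj₁ (inj₁ refl)        = 0 , []
... | inj₁ (inj₂ u~v)         = 1 , u~v ∷ []
... | inj₂ (w , u~w , w~v)    = 2 , u~w ∷ (w~v ∷ [])

¬covers⇒distance≥2 : ∀ G {u v} → ¬ Covers G u v → ∀ k → Walk G u v k → 2 ≤ k
¬covers⇒distance≥2 G ¬cov _ []              = contradiction (inj₁ refl) ¬cov
¬covers⇒distance≥2 G ¬cov _ (e ∷ [])        = contradiction (inj₂ e) ¬cov
¬covers⇒distance≥2 G ¬cov _ (_ ∷ (_ ∷ _))   = s≤s (s≤s z≤n)

near⇒distance : ∀ G {u v} → ¬ Covers G u v → Near G u v → IsDistance G u v 2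
near⇒distance G ¬cov (inj₁ cov)             = contradiction cov ¬cov
near⇒distance G ¬cov (inj₂ (w , u~w , w~v)) = u~w ∷ (w~v ∷ []) , ¬covers⇒distance≥2 G ¬cov

diameter-2 : ∀ G {u v} → (∀ u v → Near G u v) → ¬ Covers G u v → IsDiameter G 2
diameter-2 G near ¬cov = close , _ , _ , near⇒distance G ¬cov (near _ _)
  where
  open Graph G hiding (order; Vertex)
  close : ∀ u v → ∃ λ e → IsDistance G u v e × e ≤ 2
  close u v with covers? G u v
  ... | yes (inj₁ refl) = 0 , ([] , λ _ _ → z≤n) , z≤n
  ... | yes (inj₂ u~v)  = 1 , (u~v ∷ [] , λ where
          _ []      → contradiction u~v (~-irrefl u)
          _ (_ ∷ _) → s≤s z≤n) , s≤s z≤n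
  ... | no ¬uv          = 2 , near⇒distance G ¬uv (near u v) , ≤-refl

-- A graph against its complement

-- A vertex covered by neither `u` nor `v` is a common neighbour of both in the complement.
¬pair⇒complement-near : ∀ G → ¬ ∃₂ (CoveringPair G) → ∀ u v → Near (complement G) u v
¬pair⇒complement-near G ∄pair u v
  with ¬∀⟶∃¬ (order G) _ (λ w → covers? G u w ⊎-dec covers? G v w) (λ pair → ∄pair (u , v , pair))
... | w , ¬cov = inj₂ (w , (¬cov ∘ inj₁ ∘ inj₁ , ¬cov ∘ inj₁ ∘ inj₂)
                         , (¬cov ∘ inj₂ ∘ inj₁ ∘ sym , ¬cov ∘ inj₂ ∘ inj₂ ∘ Graph.~-sym G))

-- A vertex that both miss in the complement would be a common neighbour in `G`, putting them at
-- distance at most 2.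
¬near⇒complement-pair : ∀ G {u v} → ¬ Near G u v → CoveringPair (complement G) u v
¬near⇒complement-pair G {u} {v} ¬near w with covers? (complement G) u w | covers? (complement G) v w
... | yes cov | _       = inj₁ cov
... | no _    | yes cov = inj₂ cov
... | no ¬u   | no ¬v   = contradiction (inj₂ (w , adjacent ¬u , ~-sym (adjacent ¬v))) ¬near
  where
  open Graph G hiding (order; Vertex)
  adjacent : ∀ {a} → ¬ Covers (complement G) a w → a ~ w
  adjacent {a} ¬cov = decidable-stable (a ~? w) λ a≁w → ¬cov (inj₂ (¬cov ∘ inj₁ , a≁w))

~⇒¬complement-covers : ∀ G {u v} → Graph._~_ G u v → ¬ Covers (complement G) u v
~⇒¬complement-covers G u~v (inj₁ refl)      = Graph.~-irrefl G _ u~v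
~⇒¬complement-covers G u~v (inj₂ (_ , u≁v)) = u≁v u~v

-- A walk from `u` to an uncovered vertex is nonempty, and its first edge gives the neighbour.
neighbour : ∀ G → Connected G → ∀ {u} → ¬ Universal G u → ∃ λ w → Graph._~_ G u w
neighbour G conn {u} ¬univ with ¬universal⇒uncovered G ¬univ
... | w , ¬cov with conn u w
... | _ , []      = contradiction (inj₁ refl) ¬cov
... | _ , (e ∷ _) = _ , e

-- The case distinction

Exceptional : Graph → Set
Exceptional G = IsDominationNumber G 2 ⊎ (IsDiameter G 2 × IsDiameter (complement G) 2)

reduction :
  (∀ G → 3 ≤ order G → Connected G → Exceptional G → Reconstructible G) →
  ∀ G → 3 ≤ order G → Connected G → Reconstructible G
reduction exceptional G n≥3 conn with any? (universal? G)
... | yes (_ , univ) = universal⇒reconstructible G n≥3 univ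
... | no ∄univ with any? (λ u → any? (coveringPair? G u))
...   | yes (u , v , pair) =
        exceptional G n≥3 conn (inj₁ (dominationNumber-2 G (λ w univ → ∄univ (w , univ)) pair))
...   | no ∄pair with any? (λ u → any? (λ v → ¬? (near? G u v)))
-- The hypothesis is applied to the complement, which is connected because any two of its vertices
-- are near.
...     | yes (u , v , ¬near) = reconstructible-complement G
          (exceptional (complement G) n≥3
            (near⇒connected (complement G) (¬pair⇒complement-near G ∄pair))
            (inj₁ (dominationNumber-2 (complement G) ¬complement-univ (¬near⇒complement-pair G ¬near))))
  where
  -- A universal vertex of the complement would be isolated in `G`.
  ¬complement-univ : ∀ w → ¬ Universal (complement G) w
  ¬complement-univ w univ with neighbour G conn (λ univ′ → ∄univ (w , univ′))
  ... | x , w~x = ~⇒¬complement-covers G w~x (univ x)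
...     | no ∄far = exceptional G n≥3 conn (inj₂
          ( diameter-2 G near (proj₂ (¬universal⇒uncovered G ¬univ₀))
          , diameter-2 (complement G) (¬pair⇒complement-near G ∄pair)
              (~⇒¬complement-covers G (proj₂ (neighbour G conn ¬univ₀)))))
  where
  near : ∀ u v → Near G u v
  near u v = decidable-stable (near? G u v) λ ¬near → ∄far (u , v , ¬near)
  -- This vertex provides both pairs at distance exactly 2: with a vertex it does not cover in `G`,
  -- and with a neighbour in the complement.
  v₀ : Vertex G
  v₀ = fromℕ< (≤-trans (s≤s z≤n) n≥3)
  ¬univ₀ : ¬ Universal G v₀
  ¬univ₀ univ = ∄univ (v₀ , univ)

theorem5 : (∀ (G : Graph) → 3 ≤ Graph.order G → Connected G → Reconstructible G)
    ⇔
    (∀ (G : Graph) → 3 ≤ Graph.order G → Connected G →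
    IsDominationNumber G 2 ⊎ (IsDiameter G 2 × IsDiameter (complement G) 2) →
    Reconstructible G)
theorem5 = mk⇔ (λ all G n≥3 conn _ → all G n≥3 conn) reduction
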